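{- Fix a prime $p$. For $i\in\omega$ let $\mathcal{A}_i=\bigoplus_{j\in\omega}\mathbb{Z}(p^{i+1})$, viewed as a structure in the signature $\{+,0\}$, let $\mathfrak{K}_{ag}=\{\mathcal{A}_i:i\in\omega\}$, and let $\nu_{ag}$ be the effective enumeration with $\nu_{ag}(i)$ a natural computable copy of $\mathcal{A}_i$. Then $\mathfrak{K}_{ag}$ is $\mathbf{InfEx}_{\cong}[\nu_{ag}]$-learnable by a computable learner.
   Context: $\mathbb{Z}(p^{n})$ is the cyclic group of order $p^n$. Functions are treated via their graphs, so the signature is relational. For $L=\{P_0^{n_0},\dots,P_k^{n_k}\}$, an $L$-informant is $I$ on $\omega$ with $I(m)=(I_0(m),\dots,I_k(m))$, $I_j(m)\in\omega^{n_j}\times\{0,1\}$; it is an informant for $\mathcal{S}$ (domain $\omega$) if for every $j$, $\mathrm{range}(I_j)=\{(\bar a,1):\bar a\in P_j^{\mathcal{S}}\}\cup\{(\bar a,0):\bar a\notin P_j^{\mathcal{S}}\}$; $I[n]=I(0),\dots,I(n-1)$. A learner is a function from finite initial segments of informants to $\omega\cup\{?\}$. An effective enumeration of a class is $\nu:\omega\to$ class with $(\nu(e))_e$ uniformly computable and every member isomorphic to some $\nu(e)$. A class $\mathfrak{C}$ (closed under isomorphism, domain $\omega$) is $\mathbf{InfEx}_{\cong}[\nu]$-learnable via $M$ if for every $\mathcal{A}\in\mathfrak{C}$ and every informant $I$ for $\mathcal{A}$ there are $e,s_0$ with $\nu(e)\cong\mathcal{A}$ and $M(I[s])=e$ for all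 $s\ge s_0$. -}

module Defs where

open import Data.Nat using (ℕ; zero; suc; _+_; _^_; _≤_; NonZero)
open import Data.Nat.DivMod using (_/_; _%_)
open import Data.Nat.Properties using (m^n≢0)
open import Data.Bool using (Bool; true; false)
open import Data.Maybe using (Maybe; just; nothing)
open import Data.List using (List; applyUpTo)
open import Data.Product using (Σ; ∃; _×_; _,_; proj₁; proj₂)
open import Function.Bundles using (_⤖_; _⇔_; Bijection)
open import Relation.Nullary using (¬_)
open import Relation.Binary.PropositionalEquality using (_≡_)

-- Structures with domain ω in the relational signature {P₀³, P₁¹}:
-- P₀ = graph of + (ternary), P₁ = graph of the constant 0 (unary).
record Structure : Set₁ where
  field
    Plus : ℕ → ℕ → ℕ → Set
    Zero : ℕ → Set
open Structure public

_≅_ : Structure → Structure → Set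
A ≅ B = Σ (ℕ ⤖ ℕ) λ f → let g = Bijection.to f in
  (∀ a b c → Plus A a b c ⇔ Plus B (g a) (g b) (g c)) ×
  (∀ a → Zero A a ⇔ Zero B (g a))

Entry : Set
Entry = ((ℕ × ℕ × ℕ) × Bool) × (ℕ × Bool)

Informant : Set
Informant = ℕ → Entry

RangeIs : {X : Set} → (ℕ → X × Bool) → (X → Set) → Set
RangeIs {X} J P = ∀ (x : X) →
  ((∃ λ m → J m ≡ (x , true)) ⇔ P x) × ((∃ λ m → J m ≡ (x , false)) ⇔ (¬ P x))

IsInformantFor : Informant → Structure → Set
IsInformantFor I S =
  RangeIs (λ m → proj₁ (I m)) (λ t → Plus S (proj₁ t) (proj₁ (proj₂ t)) (proj₂ (proj₂ t))) ×
  RangeIs (λ m → proj₂ (I m)) (Zero S)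

initSeg : Informant → ℕ → List Entry
initSeg I s = applyUpTo I s

-- a learner; nothing plays the role of '?'
Learner : Set
Learner = List Entry → Maybe ℕ

digit : (q : ℕ) → .{{NonZero q}} → ℕ → ℕ → ℕ
digit q k n = (n / (q ^ k) ) {{m^n≢0 q k}} % q

-- natural copy of ⊕_{j∈ω} Z(p^{i+1}): n ∈ ω codes the finitely supported
-- sequence of its base-p^{i+1} digits; addition is digitwise mod p^{i+1}.
νag : (p : ℕ) → NonZero p → ℕ → Structure
νag p nz i = record
  { Plus = λ a b c → ∀ k → (digit q k a + digit q k b) % q ≡ digit q k c
  ; Zero = λ a → a ≡ 0 }
  where
  instance
    qnz : NonZero (p ^ suc i)
    qnz = m^n≢0 p (suc i) {{nz}}
  q : ℕ
  q = p ^ suc i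

InfExLearns : (ℕ → Structure) → (Structure → Set) → Learner → Set₁
InfExLearns ν K M = ∀ (A : Structure) → K A → ∀ (I : Informant) → IsInformantFor I A →
  ¬ ¬ (Σ ℕ λ e → Σ ℕ λ s₀ → (ν e ≅ A) × (∀ s → s₀ ≤ s → M (initSeg I s) ≡ just e))

-- Every element of 𝒜ᵢ is killed by q = p^(i+1), while p^i · e ≠ 0 for a generator e
-- of a summand; so i is the largest j with p^j · a ≠ 0 for some a.  The learner reads
-- the zero and the sums m + a off the positive part of the informant seen so far and
-- outputs the largest j < s such that, for some a < s, these data determine p^j · a
-- and it differs from the zero.  Positive data are true in the structure, so the
-- output never exceeds i; once the zero and the sums building p^i · e have appeared,
-- and s > e, i, the output is exactly i.
module Submission where

open import Defs
open import Data.Bool using (true; false)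
open import Data.Empty using (⊥-elim)
open import Data.List using (List; []; _∷_; length; applyUpTo)
open import Data.List.Extrema.Nat using (max; max≤v⁺; v≤max⁺)
open import Data.List.Membership.Propositional using (_∈_)
open import Data.List.Membership.Propositional.Properties using (∈-applyUpTo⁺; ∈-applyUpTo⁻)
open import Data.List.Properties using (length-applyUpTo)
open import Data.List.Relation.Unary.All.Properties using (applyUpTo⁺₁)
open import Data.List.Relation.Unary.Any using (here; there)
open import Data.List.Relation.Unary.Any.Properties using (applyUpTo⁺)
open import Data.Maybe using (Maybe; just; nothing; _>>=_; _<∣>_)
open import Data.Nat
open import Data.Nat.DivMod
open import Data.Nat.Divisibility using (_∣_; divides; n∣m⇒m%n≡0; ∣m⇒∣m*n)
open import Data.Nat.Primality using (Prime; prime⇒nonZero; prime⇒nonTrivial)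
open import Data.Nat.Properties
open import Data.Product using (Σ; ∃; _×_; _,_; proj₁; proj₂)
open import Data.Sum using (inj₂)
open import Function using (id)
open import Function.Bundles using (_⇔_; Bijection; Equivalence; Surjection; mk⇔)
open import Function.Construct.Composition using (_⇔-∘_)
open import Function.Construct.Symmetry using (⤖-sym; ⇔-sym)
open import Relation.Binary.PropositionalEquality
open import Relation.Nullary using (yes; no)

module Digits (q : ℕ) .{{q≢0 : NonZero q}} (1<q : 1 < q) where

  digit-zero : ∀ n → digit q 0 n ≡ n % q
  digit-zero n = cong (_% q) (n/1≡n n)

  digit-suc : ∀ k n → digit q (suc k) n ≡ digit q k (n / q)
  digit-suc k n =
    cong (_% q) (sym (m/n/o≡m/[n*o] n q (q ^ k) {{q≢0}} {{m^n≢0 q k}} {{m^n≢0 q (suc k)}}))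

  digit-< : ∀ k n → digit q k n < q
  digit-< k n = m%n<n _ q

  digit-of-0 : ∀ k → digit q k 0 ≡ 0
  digit-of-0 k = trans (cong (_% q) (0/n≡0 (q ^ k) {{m^n≢0 q k}})) (m<n⇒m%n≡m (<⇒≤ 1<q))

  digit-suc-of-< : ∀ k {n} → n < q → digit q (suc k) n ≡ 0
  digit-suc-of-< k {n} n<q = begin
    digit q (suc k) n  ≡⟨ digit-suc k n ⟩
    digit q k (n / q)  ≡⟨ cong (digit q k) (m<n⇒m/n≡0 n<q) ⟩
    digit q k 0        ≡⟨ digit-of-0 k ⟩
    0                  ∎
    where open ≡-Reasoning

  digits-injective : ∀ n m → (∀ k → digit q k n ≡ digit q k m) → n ≡ m
  digits-injective n m = injective-below (n + m) (m≤m+n n m) (m≤n+m m n)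
    where
    /q-≤ : ∀ {b} n → n ≤ suc b → n / q ≤ b
    /q-≤ zero        _  = ≤-trans (≤-reflexive (0/n≡0 q)) z≤n
    /q-≤ n@(suc _) n≤1+b = <⇒≤pred (≤-trans (m/n<m n q 1<q) n≤1+b)

    -- b is fuel: n / q < n for n > 0
    injective-below : ∀ b {n m} → n ≤ b → m ≤ b → (∀ k → digit q k n ≡ digit q k m) → n ≡ m
    injective-below zero    z≤n z≤n _ = refl
    injective-below (suc b) {n} {m} n≤ m≤ same = begin
      n                    ≡⟨ m≡m%n+[m/n]*n n q ⟩
      n % q + (n / q) * q  ≡⟨ cong₂ (λ r d → r + d * q) same-rem same-quot ⟩
      m % q + (m / q) * q  ≡⟨ m≡m%n+[m/n]*n m q ⟨
      m                    ∎
      where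
      open ≡-Reasoning
      same-rem : n % q ≡ m % q
      same-rem = trans (sym (digit-zero n)) (trans (same 0) (digit-zero m))
      same-quot : n / q ≡ m / q
      same-quot = injective-below b (/q-≤ n n≤) (/q-≤ m m≤)
        (λ k → trans (sym (digit-suc k n)) (trans (same (suc k)) (digit-suc k m)))

[m%n+o]%n≡[m+o]%n : ∀ m o n .{{_ : NonZero n}} → (m % n + o) % n ≡ (m + o) % n
[m%n+o]%n≡[m+o]%n m o n = begin
  (m % n + o) % n          ≡⟨ %-distribˡ-+ (m % n) o n ⟩
  (m % n % n + o % n) % n  ≡⟨ cong (λ r → (r + o % n) % n) (m%n%n≡m%n m n) ⟩
  (m % n + o % n) % n      ≡⟨ %-distribˡ-+ m o n ⟨
  (m + o) % n              ∎
  where open ≡-Reasoning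

^-monoʳ-∣ : ∀ p {m n} → m ≤ n → p ^ m ∣ p ^ n
^-monoʳ-∣ p {m} {n} m≤n = divides (p ^ (n ∸ m)) (begin
  p ^ n              ≡⟨ cong (p ^_) (m+[n∸m]≡n m≤n) ⟨
  p ^ (m + (n ∸ m))  ≡⟨ ^-distribˡ-+-* p m (n ∸ m) ⟩
  p ^ m * p ^ (n ∸ m) ≡⟨ *-comm (p ^ m) _ ⟩
  p ^ (n ∸ m) * p ^ m ∎)
  where open ≡-Reasoning

PlusFunctional : Structure → Set
PlusFunctional S = ∀ {a b c c′} → Plus S a b c → Plus S a b c′ → c ≡ c′

-- Multiple S a k c : c is the sum of k + 1 copies of a in S
data Multiple (S : Structure) (a : ℕ) : ℕ → ℕ → Set where
  once : Multiple S a 0 a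
  step : ∀ {k m c} → Multiple S a k m → Plus S m a c → Multiple S a (suc k) c

plus-cong : ∀ S {a b c a′ b′ c′} → a ≡ a′ → b ≡ b′ → c ≡ c′ →
            Plus S a b c ⇔ Plus S a′ b′ c′
plus-cong S refl refl refl = mk⇔ id id

zero-cong : ∀ S {a a′} → a ≡ a′ → Zero S a ⇔ Zero S a′
zero-cong S refl = mk⇔ id id

≅-sym : ∀ {A B} → A ≅ B → B ≅ A
≅-sym {A} {B} (f , plus⇔ , zero⇔) =
  ⤖-sym f
  , (λ a b c → ⇔-sym (plus⇔ (to⁻ a) (to⁻ b) (to⁻ c))
               ⇔-∘ plus-cong B (sym (to∘to⁻ a)) (sym (to∘to⁻ b)) (sym (to∘to⁻ c)))
  , (λ a → ⇔-sym (zero⇔ (to⁻ a)) ⇔-∘ zero-cong B (sym (to∘to⁻ a)))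
  where open Surjection (Bijection.surjection f) using (to⁻; to∘to⁻)

module _ {A B : Structure} (A≅B : A ≅ B) where
  open Bijection (proj₁ A≅B) using (to; injective)

  plus⇒ : ∀ {a b c} → Plus A a b c → Plus B (to a) (to b) (to c)
  plus⇒ = Equivalence.to (proj₁ (proj₂ A≅B) _ _ _)

  ≅-preserves-Multiple : ∀ {a k c} → Multiple A a k c → Multiple B (to a) k (to c)
  ≅-preserves-Multiple once       = once
  ≅-preserves-Multiple (step M P) = step (≅-preserves-Multiple M) (plus⇒ P)

  ≅-reflects-PlusFunctional : PlusFunctional B → PlusFunctional A
  ≅-reflects-PlusFunctional functional P P′ = injective (functional (plus⇒ P) (plus⇒ P′))

module NaturalCopy (p : ℕ) (p≢0 : NonZero p) (1<p : 1 < p) (i : ℕ) where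

  q : ℕ
  q = p ^ suc i

  instance
    q≢0 : NonZero q
    q≢0 = m^n≢0 p (suc i) {{p≢0}}

  1<q : 1 < q
  1<q = ^-monoʳ-< p 1<p {0} {suc i} z<s

  open Digits q 1<q

  ν : Structure
  ν = νag p p≢0 i

  plus-functional : PlusFunctional ν
  plus-functional P P′ = digits-injective _ _ λ d → trans (sym (P d)) (P′ d)

  plus-below : ∀ {a b} → a < q → b < q → Plus ν a b ((a + b) % q)
  plus-below {a} {b} _ _ zero = begin
    (digit q 0 a + digit q 0 b) % q  ≡⟨ cong₂ (λ x y → (x + y) % q) (digit-zero a) (digit-zero b) ⟩
    (a % q + b % q) % q              ≡⟨ %-distribˡ-+ a b q ⟨
    (a + b) % q                      ≡⟨ m%n%n≡m%n (a + b) q ⟨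
    (a + b) % q % q                  ≡⟨ digit-zero _ ⟨
    digit q 0 ((a + b) % q)          ∎
    where open ≡-Reasoning
  plus-below {a} {b} a<q b<q (suc d) = begin
    (digit q (suc d) a + digit q (suc d) b) % q
      ≡⟨ cong₂ (λ x y → (x + y) % q) (digit-suc-of-< d a<q) (digit-suc-of-< d b<q) ⟩
    0 % q                          ≡⟨ m<n⇒m%n≡m (<⇒≤ 1<q) ⟩
    0                              ≡⟨ digit-suc-of-< d (m%n<n (a + b) q) ⟨
    digit q (suc d) ((a + b) % q)  ∎
    where open ≡-Reasoning

  multiple-digit : ∀ {a k c} → Multiple ν a k c → ∀ d → digit q d c ≡ (suc k * digit q d a) % q
  multiple-digit {a} once d = begin
    digit q d a            ≡⟨ m<n⇒m%n≡m (digit-< d a) ⟨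
    digit q d a % q        ≡⟨ cong (_% q) (*-identityˡ _) ⟨
    (1 * digit q d a) % q  ∎
    where open ≡-Reasoning
  multiple-digit {a} (step {k} {m} {c} M P) d = begin
    digit q d c                ≡⟨ P d ⟨
    (digit q d m + x) % q      ≡⟨ cong (λ y → (y + x) % q) (multiple-digit M d) ⟩
    ((suc k * x) % q + x) % q  ≡⟨ [m%n+o]%n≡[m+o]%n (suc k * x) x q ⟩
    (suc k * x + x) % q        ≡⟨ cong (_% q) (+-comm (suc k * x) x) ⟩
    (suc (suc k) * x) % q      ∎
    where
    open ≡-Reasoning
    x = digit q d a

  multiple≡0 : ∀ {a k c} → q ∣ suc k → Multiple ν a k c → c ≡ 0
  multiple≡0 q∣1+k M = digits-injective _ 0 λ d →
    trans (multiple-digit M d) (trans (n∣m⇒m%n≡0 _ q (∣m⇒∣m*n _ q∣1+k)) (sym (digit-of-0 d)))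

  multiple-of-1 : ∀ k → Multiple ν 1 k (suc k % q)
  multiple-of-1 zero    = subst (Multiple ν 1 0) (sym (m<n⇒m%n≡m 1<q)) once
  multiple-of-1 (suc k) = subst (Multiple ν 1 (suc k)) sum≡
    (step (multiple-of-1 k) (plus-below (m%n<n (suc k) q) 1<q))
    where
    sum≡ : (suc k % q + 1) % q ≡ suc (suc k) % q
    sum≡ = trans ([m%n+o]%n≡[m+o]%n (suc k) 1 q) (cong (_% q) (+-comm (suc k) 1))

firstJust : {A B : Set} → (A → Maybe B) → List A → Maybe B
firstJust f []       = nothing
firstJust f (x ∷ xs) = f x <∣> firstJust f xs

firstJust-sound : ∀ {A B : Set} (f : A → Maybe B) xs {b} →
  firstJust f xs ≡ just b → ∃ λ x → x ∈ xs × f x ≡ just b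
firstJust-sound f (x ∷ xs) eq with f x in fx
... | just _  = x , here refl , trans fx eq
... | nothing with firstJust-sound f xs eq
...   | y , y∈xs , fy = y , there y∈xs , fy

firstJust-defined : ∀ {A B : Set} (f : A → Maybe B) {xs x b} →
  x ∈ xs → f x ≡ just b → ∃ λ b′ → firstJust f xs ≡ just b′
firstJust-defined f {y ∷ xs} x∈ fx with f y in fy
... | just b′ = b′ , refl
firstJust-defined f (here refl) fx | nothing with () ← trans (sym fy) fx
firstJust-defined f (there x∈) fx | nothing = firstJust-defined f x∈ fx

sumOf : ℕ → ℕ → Entry → Maybe ℕ
sumOf a b (((a′ , b′ , c) , true) , _) with a′ ≟ a | b′ ≟ b
... | yes _ | yes _ = just c
... | _     | _     = nothing
sumOf a b ((_ , false) , _) = nothing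

sumOf-sound : ∀ a b e {c} → sumOf a b e ≡ just c → proj₁ e ≡ ((a , b , c) , true)
sumOf-sound a b (((a′ , b′ , _) , true) , _) eq with a′ ≟ a | b′ ≟ b
sumOf-sound a b _ refl | yes refl | yes refl = refl

sumOf-complete : ∀ a b e {c} → proj₁ e ≡ ((a , b , c) , true) → sumOf a b e ≡ just c
sumOf-complete a b (_ , _) refl with a ≟ a | b ≟ b
... | yes _  | yes _  = refl
... | no a≢a | _      = ⊥-elim (a≢a refl)
... | yes _  | no b≢b = ⊥-elim (b≢b refl)

zeroOf : Entry → Maybe ℕ
zeroOf (_ , (z , true))  = just z
zeroOf (_ , (_ , false)) = nothing

zeroOf-sound : ∀ e {z} → zeroOf e ≡ just z → proj₂ e ≡ (z , true)
zeroOf-sound (_ , (_ , true)) refl = refl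

zeroOf-complete : ∀ e {z} → proj₂ e ≡ (z , true) → zeroOf e ≡ just z
zeroOf-complete (_ , _) refl = refl

sumIn : List Entry → ℕ → ℕ → Maybe ℕ
sumIn F a b = firstJust (sumOf a b) F

zeroIn : List Entry → Maybe ℕ
zeroIn = firstJust zeroOf

multipleIn : List Entry → ℕ → ℕ → Maybe ℕ
multipleIn F a zero    = just a
multipleIn F a (suc k) = multipleIn F a k >>= λ m → sumIn F m a

maxBelow : ℕ → (ℕ → ℕ) → ℕ
maxBelow n f = max 0 (applyUpTo f n)

maxBelow-≤ : ∀ n f {B} → (∀ {x} → x < n → f x ≤ B) → maxBelow n f ≤ B
maxBelow-≤ n f bound = max≤v⁺ z≤n (applyUpTo⁺₁ f n bound)

≤-maxBelow : ∀ {n} f {x} → x < n → f x ≤ maxBelow n f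
≤-maxBelow f x<n = v≤max⁺ 0 _ (inj₂ (applyUpTo⁺ f ≤-refl x<n))

exponentEvidence : ℕ → List Entry → ℕ → ℕ → ℕ → ℕ
exponentEvidence p F z a j with multipleIn F a (pred (p ^ j))
... | nothing = 0
... | just c with c ≟ z
...   | yes _ = 0
...   | no _  = j

exponentEvidence-≤ : ∀ p F z a j {i} →
  (∀ {c} → multipleIn F a (pred (p ^ j)) ≡ just c → c ≢ z → j ≤ i) → exponentEvidence p F z a j ≤ i
exponentEvidence-≤ p F z a j bound with multipleIn F a (pred (p ^ j))
... | nothing = z≤n
... | just c with c ≟ z
...   | yes _   = z≤n
...   | no c≢z  = bound refl c≢z

exponentEvidence-≡ : ∀ p F z a j {c} →
  multipleIn F a (pred (p ^ j)) ≡ just c → c ≢ z → exponentEvidence p F z a j ≡ j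
exponentEvidence-≡ p F z a j {c} eq c≢z rewrite eq with c ≟ z
... | yes c≡z = ⊥-elim (c≢z c≡z)
... | no _    = refl

guess : ℕ → List Entry → ℕ
guess p F with zeroIn F
... | nothing = 0
... | just z  = maxBelow (length F) (λ a → maxBelow (length F) (exponentEvidence p F z a))

learner : ℕ → Learner
learner p F = just (guess p F)

guess-≡ : ∀ p F {z a i} → zeroIn F ≡ just z →
  (∀ a j → exponentEvidence p F z a j ≤ i) →
  a < length F → i < length F → exponentEvidence p F z a i ≡ i → guess p F ≡ i
guess-≡ p F {z} {a} {i} eq bounded a<n i<n attained rewrite eq = ≤-antisym
  (maxBelow-≤ n _ λ {a} _ → maxBelow-≤ n _ λ {j} _ → bounded a j)
  (begin
    i                                      ≡⟨ attained ⟨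
    exponentEvidence p F z a i             ≤⟨ ≤-maxBelow (exponentEvidence p F z a) i<n ⟩
    maxBelow n (exponentEvidence p F z a)  ≤⟨ ≤-maxBelow (λ a → maxBelow n (exponentEvidence p F z a)) a<n ⟩
    maxBelow n (λ a → maxBelow n (exponentEvidence p F z a))  ∎)
  where
  open ≤-Reasoning
  n = length F

module Informed {A : Structure} {I : Informant} (inf : IsInformantFor I A) where

  plus⇔ : ∀ a b c → (∃ λ t → proj₁ (I t) ≡ ((a , b , c) , true)) ⇔ Plus A a b c
  plus⇔ a b c = proj₁ (proj₁ inf (a , b , c))

  zero⇔ : ∀ z → (∃ λ t → proj₂ (I t) ≡ (z , true)) ⇔ Zero A z
  zero⇔ z = proj₁ (proj₂ inf z)

  plusPosition : ∀ {a b c} → Plus A a b c → ℕ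
  plusPosition P = proj₁ (Equivalence.from (plus⇔ _ _ _) P)

  zeroPosition : ∀ {z} → Zero A z → ℕ
  zeroPosition Z = proj₁ (Equivalence.from (zero⇔ _) Z)

  sumIn-sound : ∀ s {a b c} → sumIn (initSeg I s) a b ≡ just c → Plus A a b c
  sumIn-sound s {a} {b} eq with firstJust-sound (sumOf a b) (initSeg I s) eq
  ... | e , e∈ , sum≡ with ∈-applyUpTo⁻ I e∈
  ...   | t , _ , refl = Equivalence.to (plus⇔ _ _ _) (t , sumOf-sound a b (I t) sum≡)

  sumIn-complete : ∀ {s a b c} → PlusFunctional A → (P : Plus A a b c) →
    plusPosition P < s → sumIn (initSeg I s) a b ≡ just c
  sumIn-complete {s} {a} {b} functional P t<s
    with firstJust-defined (sumOf a b) (∈-applyUpTo⁺ I t<s)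
           (sumOf-complete a b _ (proj₂ (Equivalence.from (plus⇔ _ _ _) P)))
  ... | c′ , eq = trans eq (cong just (functional (sumIn-sound s eq) P))

  zeroIn-sound : ∀ s {z} → zeroIn (initSeg I s) ≡ just z → Zero A z
  zeroIn-sound s eq with firstJust-sound zeroOf (initSeg I s) eq
  ... | e , e∈ , zero≡ with ∈-applyUpTo⁻ I e∈
  ...   | t , _ , refl = Equivalence.to (zero⇔ _) (t , zeroOf-sound (I t) zero≡)

  zeroIn-defined : ∀ {s z} (Z : Zero A z) → zeroPosition Z < s →
                   ∃ λ z′ → zeroIn (initSeg I s) ≡ just z′
  zeroIn-defined Z t<s = firstJust-defined zeroOf (∈-applyUpTo⁺ I t<s)
    (zeroOf-complete _ (proj₂ (Equivalence.from (zero⇔ _) Z)))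

  multipleIn-sound : ∀ s {a} k {c} → multipleIn (initSeg I s) a k ≡ just c → Multiple A a k c
  multipleIn-sound s zero    refl = once
  multipleIn-sound s {a} (suc k) eq with multipleIn (initSeg I s) a k in eqₖ
  ... | just m = step (multipleIn-sound s k eqₖ) (sumIn-sound s eq)

  -- the length of an initial segment of I that shows every sum in the derivation
  stage : ∀ {a k c} → Multiple A a k c → ℕ
  stage once       = 0
  stage (step M P) = stage M ⊔ suc (plusPosition P)

  multipleIn-complete : ∀ {s a k c} → PlusFunctional A → (M : Multiple A a k c) →
    stage M ≤ s → multipleIn (initSeg I s) a k ≡ just c
  multipleIn-complete functional once _ = refl
  multipleIn-complete {s} functional (step M P) M≤s
    rewrite multipleIn-complete functional M (m⊔n≤o⇒m≤o (stage M) _ M≤s)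
    = sumIn-complete functional P (m⊔n≤o⇒n≤o (stage M) _ M≤s)

module Convergence (p : ℕ) (p≢0 : NonZero p) (1<p : 1 < p) (i : ℕ) {A : Structure}
  (A≅ν : A ≅ νag p p≢0 i) {I : Informant} (inf : IsInformantFor I A) where

  open NaturalCopy p p≢0 1<p i
  open Informed inf
  open Bijection (proj₁ A≅ν) using (to; injective; surjection)
  open Surjection surjection using (to⁻; to∘to⁻)

  ν≅A : ν ≅ A
  ν≅A = ≅-sym A≅ν

  to-zero : ∀ {z} → Zero A z → to z ≡ 0
  to-zero Z = Equivalence.to (proj₂ (proj₂ A≅ν) _) Z

  evidence-≤ : ∀ s {z} → Zero A z → ∀ a j → exponentEvidence p (initSeg I s) z a j ≤ i
  evidence-≤ s {z} Z a j = exponentEvidence-≤ p _ z a j λ {c} eq c≢z → ≮⇒≥ λ i<j →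
    c≢z (injective (trans (to-c≡0 i<j (multipleIn-sound s _ eq)) (sym (to-zero Z))))
    where
    to-c≡0 : ∀ {c} → i < j → Multiple A a (pred (p ^ j)) c → to c ≡ 0
    to-c≡0 i<j M = multiple≡0
      (subst (q ∣_) (sym (suc-pred (p ^ j) {{m^n≢0 p j {{p≢0}}}})) (^-monoʳ-∣ p i<j))
      (≅-preserves-Multiple A≅ν M)

  generator : ℕ
  generator = to⁻ 1

  K : ℕ
  K = pred (p ^ i)

  chain : Multiple A generator K (to⁻ (suc K % q))
  chain = ≅-preserves-Multiple ν≅A (multiple-of-1 K)

  chain-nonzero : ∀ {z} → Zero A z → to⁻ (suc K % q) ≢ z
  chain-nonzero Z eq = ≢-nonZero⁻¹ (p ^ i) {{m^n≢0 p i {{p≢0}}}} (begin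
    p ^ i                 ≡⟨ m<n⇒m%n≡m (^-monoʳ-< p 1<p (n<1+n i)) ⟨
    p ^ i % q             ≡⟨ cong (_% q) (suc-pred (p ^ i) {{m^n≢0 p i {{p≢0}}}}) ⟨
    suc K % q             ≡⟨ to∘to⁻ _ ⟨
    to (to⁻ (suc K % q))  ≡⟨ cong to eq ⟩
    to _                  ≡⟨ to-zero Z ⟩
    0                     ∎)
    where open ≡-Reasoning

  zero₀ : Zero A (to⁻ 0)
  zero₀ = Equivalence.to (proj₂ (proj₂ ν≅A) 0) refl

  revealed : ℕ
  revealed = generator ⊔ i ⊔ zeroPosition zero₀

  s₀ : ℕ
  s₀ = suc revealed ⊔ stage chain

  revealed-< : ∀ {s x} → s₀ ≤ s → x ≤ revealed → x < s
  revealed-< s₀≤s x≤ = ≤-trans (s≤s x≤) (m⊔n≤o⇒m≤o _ (stage chain) s₀≤s)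

  converges : ∀ s → s₀ ≤ s → learner p (initSeg I s) ≡ just i
  converges s s₀≤s with zeroIn-defined zero₀ (revealed-< s₀≤s (m≤n⊔m _ _))
  ... | z , zeroIn≡ = cong just (guess-≡ p (initSeg I s) zeroIn≡ (evidence-≤ s Zz)
        (in-segment (revealed-< s₀≤s (≤-trans (m≤m⊔n _ _) (m≤m⊔n _ _))))
        (in-segment (revealed-< s₀≤s (≤-trans (m≤n⊔m generator i) (m≤m⊔n _ _))))
        (exponentEvidence-≡ p _ z generator i
          (multipleIn-complete (≅-reflects-PlusFunctional {B = ν} A≅ν plus-functional) chain
            (m⊔n≤o⇒n≤o _ (stage chain) s₀≤s))
          (chain-nonzero Zz)))
    where
    in-segment : ∀ {x} → x < s → x < length (initSeg I s)
    in-segment = subst (_ <_) (sym (length-applyUpTo I s))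
    Zz : Zero A z
    Zz = zeroIn-sound s zeroIn≡

proposition4p4 : (p : ℕ) → (pr : Prime p) →
    Σ Learner λ M → InfExLearns (νag p (prime⇒nonZero pr)) (λ A → ∃ λ i → A ≅ νag p (prime⇒nonZero pr) i) M
proposition4p4 p pr = learner p , λ A (i , A≅ν) I inf not-learned →
  let open Convergence p (prime⇒nonZero pr) (nonTrivial⇒n>1 p {{prime⇒nonTrivial pr}}) i A≅ν inf
  in not-learned (i , s₀ , ν≅A , converges)
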